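{- Let \[ M_1=\begin{pmatrix} -1 & 2 & 2 \\ -2 & 1 & 2 \\ -2 & 2 & 3 \end{pmatrix},\quad M_2=\begin{pmatrix} 1 & 2 & 2 \\ 2 & 1 & 2 \\ 2 & 2 & 3 \end{pmatrix},\quad M_3=\begin{pmatrix} 1 & -2 & 2 \\ 2 & -1 & 2 \\ 2 & -2 & 3 \end{pmatrix}. \] Consider the directed graph whose vertices are all primitive Pythagorean triples $(a,b,c)$ (positive integers with $\gcd(a,b,c)=1$ and $a^2+b^2=c^2$, viewed as column vectors), with an edge from $\mathbf{v}$ to $\mathbf{v}'$ whenever $\mathbf{v}'=M_j\mathbf{v}$ for some $j\in\{1,2,3\}$. Call a vertex $(a,b,c)$ a funnel vertex if (i) it has outdegree $3$, (ii) it has indegree $1$, and (iii) every vertex at the head of an edge coming out of $(a,b,c)$ has third coordinate greater than $c$, while the vertex at the tail of the edge going into $(a,b,c)$ has third coordinate smaller than $c$. Then every primitive Pythagorean triple other than $(3,4,5)$ and $(4,3,5)$ is a funnel vertex. -}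

module Defs where

open import Data.Integer using (ℤ; +_; -_; _+_; _*_; _<_; _>_)
open import Data.Integer.GCD using (gcd)
open import Data.Fin using (Fin; zero; suc)
open import Data.Product using (_×_; _,_; proj₁; proj₂; Σ; ∃; ∃-syntax)
open import Data.Sum using (_⊎_)
open import Relation.Binary.PropositionalEquality using (_≡_; _≢_)

Vec3 : Set
Vec3 = ℤ × ℤ × ℤ

third : Vec3 → ℤ
third (_ , _ , z) = z

-- 3×3 integer matrices, given as a triple of rows.
Mat3 : Set
Mat3 = Vec3 × Vec3 × Vec3

dot : Vec3 → Vec3 → ℤ
dot (a , b , c) (x , y , z) = a * x + b * y + c * z

_·_ : Mat3 → Vec3 → Vec3
(r₁ , r₂ , r₃) · v = dot r₁ v , dot r₂ v , dot r₃ v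

M₁ M₂ M₃ : Mat3
M₁ = ((- + 1) , + 2 , + 2) , ((- + 2) , + 1 , + 2) , ((- + 2) , + 2 , + 3)
M₂ = (+ 1 , + 2 , + 2) , (+ 2 , + 1 , + 2) , (+ 2 , + 2 , + 3)
M₃ = (+ 1 , (- + 2) , + 2) , (+ 2 , (- + 1) , + 2) , (+ 2 , (- + 2) , + 3)

M : Fin 3 → Mat3
M zero = M₁
M (suc zero) = M₂
M (suc (suc zero)) = M₃

PPT : Vec3 → Set
PPT (a , b , c) =
  (a > + 0) × (b > + 0) × (c > + 0) ×
  (gcd (gcd a b) c ≡ + 1) × (a * a + b * b ≡ c * c)

Edge : Vec3 → Vec3 → Set
Edge v w = PPT v × PPT w × ∃[ j ] (w ≡ M j · v)

OutDegree3 : Vec3 → Set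
OutDegree3 v =
  Σ Vec3 λ w₁ → Σ Vec3 λ w₂ → Σ Vec3 λ w₃ →
    Edge v w₁ × Edge v w₂ × Edge v w₃ ×
    w₁ ≢ w₂ × w₁ ≢ w₃ × w₂ ≢ w₃ ×
    (∀ w → Edge v w → w ≡ w₁ ⊎ w ≡ w₂ ⊎ w ≡ w₃)

HasUniqueInNeighbour : Vec3 → Vec3 → Set
HasUniqueInNeighbour v u = Edge u v × (∀ u′ → Edge u′ v → u′ ≡ u)

Funnel : Vec3 → Set
Funnel v =
  PPT v × OutDegree3 v ×
  (∀ w → Edge v w → third w > third v) ×
  (Σ Vec3 λ u → HasUniqueInNeighbour v u × third u < third v)

{-# OPTIONS --safe #-}

-- The three matrices preserve the form x² + y² − z² and are invertible over ℤ,
-- so they preserve primitive solutions up to signs, and only positivity is at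
-- stake.  They differ from M₂ by the sign of one column, hence the three
-- candidate parents of v are (±p , ±q , r), where (p , q , r) = M₂⁻¹ v, and the
-- only one that can be positive is (|p| , |q| , r).  Since
-- p (a + 2b + 2c) = a (4b − 3a) on the cone, p and q are never both negative,
-- and p = 0 (q = 0) forces the triple (4 , 3 , 5) (respectively (3 , 4 , 5)).
module Submission where

open import Defs
open import Data.Empty using (⊥; ⊥-elim)
open import Data.Fin using (Fin; zero; suc)
open import Data.Integer using (ℤ; +_; -_; _+_; _-_; _*_; _<_; _≤_; -[1+_]; +≤+; ∣_∣; +<+)
open import Data.Integer.Divisibility.Signed using (_∣_; divides; ∣ᵤ⇒∣; ∣⇒∣ᵤ; ∣m∣n⇒∣m+n; ∣n⇒∣m*n)
open import Data.Integer.GCD using (gcd; gcd[i,j]∣i; gcd[i,j]∣j; gcd-greatest; gcd-comm)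
open import Data.Integer.Properties using (<-cmp; <-irrefl; +-mono-<; +-mono-<-≤; *-monoˡ-≤-nonNeg; +-monoʳ-<; +-comm; <-trans; +-identityʳ; +-inverseʳ; *-zeroʳ; *-identityʳ; *-cancelˡ-≡; i≡j⇒i-j≡0; i-j≡0⇒i≡j; neg-mono-<; neg-distribʳ-*; ∣-i∣≡∣i∣)
open import Data.Integer.Solver using (module +-*-Solver)
open import Data.Integer.Tactic.RingSolver using (solve-∀)
import Data.Nat as ℕ
import Data.Nat.Divisibility as ℕ using (∣1⇒≡1; ∣-trans)
open import Data.Product using (_×_; _,_; proj₁; proj₂; ∃-syntax)
open import Data.Sum using (_⊎_; inj₁; inj₂)
open import Relation.Binary.Definitions using (tri<; tri≈; tri>)
open import Relation.Binary.PropositionalEquality using (_≡_; _≢_; refl; sym; trans; cong; cong₂; subst; subst₂)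

-- Positive integers

0<+ : ∀ {i j} → + 0 < i → + 0 < j → + 0 < i + j
0<+ = +-mono-<

0<* : ∀ {i j} → + 0 < i → + 0 < j → + 0 < i * j
0<* {+ ℕ.suc _} {+ ℕ.suc _} _ _ = +<+ (ℕ.s≤s ℕ.z≤n)
0<* {+ 0} (+<+ ())
0<* {+ ℕ.suc _} {+ 0} _ (+<+ ())

-- For negative `i`, both `k * i` and `k * (- i)` would be positive, yet they sum to zero. Used to
-- read off the sign of a linear form from its product with a positive conjugate.
0<k*i⇒0<i : ∀ {k i} → + 0 < k → + 0 < k * i → + 0 < i
0<k*i⇒0<i {k} {i} 0<k 0<ki with <-cmp (+ 0) i
... | tri< 0<i _ _ = 0<i
... | tri≈ _ refl _ = ⊥-elim (<-irrefl (sym (*-zeroʳ k)) 0<ki)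
... | tri> _ _ i<0 = ⊥-elim (<-irrefl (sym (cancel k i)) (0<+ 0<ki (0<* 0<k (neg-mono-< i<0))))
  where
  cancel : ∀ k i → k * i + k * (- i) ≡ + 0
  cancel = solve-∀

0<j-i⇒i<j : ∀ {i j} → + 0 < j - i → i < j
0<j-i⇒i<j {i} {j} 0<j-i = subst₂ _<_ (+-identityʳ i) (cancel i j) (+-monoʳ-< i 0<j-i)
  where
  cancel : ∀ i j → i + (j - i) ≡ j
  cancel = solve-∀

0<i⇒i≡+∣i∣ : ∀ {i} → + 0 < i → i ≡ + ∣ i ∣
0<i⇒i≡+∣i∣ {+ _} _ = refl

0<-i⇒-i≡+∣i∣ : ∀ {i} → + 0 < - i → - i ≡ + ∣ i ∣
0<-i⇒-i≡+∣i∣ {i} 0<-i = trans (0<i⇒i≡+∣i∣ 0<-i) (cong +_ (∣-i∣≡∣i∣ i))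

*-cancelˡ-0< : ∀ {k i j} → + 0 < k → k * i ≡ k * j → i ≡ j
*-cancelˡ-0< {+ ℕ.suc n} {i} {j} _ = *-cancelˡ-≡ (+ ℕ.suc n) i j
*-cancelˡ-0< {+ 0} (+<+ ())

0<i∧i∣1⇒i≡1 : ∀ {i} → + 0 < i → i ∣ + 1 → i ≡ + 1
0<i∧i∣1⇒i≡1 0<i i∣1 = trans (0<i⇒i≡+∣i∣ 0<i) (cong +_ (ℕ.∣1⇒≡1 (∣⇒∣ᵤ i∣1)))

-- Integer matrices

cong₃ : ∀ {x x′ y y′ z z′ : ℤ} → x ≡ x′ → y ≡ y′ → z ≡ z′ → (x , y , z) ≡ (x′ , y′ , z′)
cong₃ refl refl refl = refl

row : Vec3 → Mat3 → Vec3
row r ((a , b , c) , (d , e , f) , (g , h , i)) =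
  dot r (a , d , g) , dot r (b , e , h) , dot r (c , f , i)

_⊗_ : Mat3 → Mat3 → Mat3
(r₁ , r₂ , r₃) ⊗ B = row r₁ B , row r₂ B , row r₃ B

I₃ : Mat3
I₃ = (+ 1 , + 0 , + 0) , (+ 0 , + 1 , + 0) , (+ 0 , + 0 , + 1)

I₃-· : ∀ v → I₃ · v ≡ v
I₃-· (x , y , z) = cong₃ (e₁ x y z) (e₂ x y z) (e₃ x y z)
  where
  e₁ : ∀ x y z → + 1 * x + + 0 * y + + 0 * z ≡ x
  e₁ = solve-∀
  e₂ : ∀ x y z → + 0 * x + + 1 * y + + 0 * z ≡ y
  e₂ = solve-∀
  e₃ : ∀ x y z → + 0 * x + + 0 * y + + 1 * z ≡ z
  e₃ = solve-∀

dot-row : ∀ r B v → dot (row r B) v ≡ dot r (B · v)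
dot-row (r₁ , r₂ , r₃) ((a , b , c) , (d , e , f) , (g , h , i)) (x , y , z) =
  identity r₁ r₂ r₃ a b c d e f g h i x y z
  where
  identity : ∀ r₁ r₂ r₃ a b c d e f g h i x y z →
    (r₁ * a + r₂ * d + r₃ * g) * x + (r₁ * b + r₂ * e + r₃ * h) * y + (r₁ * c + r₂ * f + r₃ * i) * z ≡
    r₁ * (a * x + b * y + c * z) + r₂ * (d * x + e * y + f * z) + r₃ * (g * x + h * y + i * z)
  identity = solve-∀

⊗-· : ∀ A B v → (A ⊗ B) · v ≡ A · (B · v)
⊗-· (r₁ , r₂ , r₃) B v = cong₃ (dot-row r₁ B v) (dot-row r₂ B v) (dot-row r₃ B v)

-- Reduces the inverse laws to products of closed matrices, which `refl` settles by evaluation.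
⊗≡I₃⇒·-inverse : ∀ A B → A ⊗ B ≡ I₃ → ∀ v → A · (B · v) ≡ v
⊗≡I₃⇒·-inverse A B AB≡I v = trans (sym (⊗-· A B v)) (trans (cong (_· v) AB≡I) (I₃-· v))

-- The Lorentz adjoints: each is J Mᵀ J with J = diag(1, 1, -1).
M⁻¹ : Fin 3 → Mat3
M⁻¹ zero             = ((- + 1) , (- + 2) , + 2) , (+ 2 , + 1 , (- + 2)) , ((- + 2) , (- + 2) , + 3)
M⁻¹ (suc zero)       = (+ 1 , + 2 , (- + 2)) , (+ 2 , + 1 , (- + 2)) , ((- + 2) , (- + 2) , + 3)
M⁻¹ (suc (suc zero)) = (+ 1 , + 2 , (- + 2)) , ((- + 2) , (- + 1) , + 2) , ((- + 2) , (- + 2) , + 3)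

M⁻¹-M : ∀ j v → M⁻¹ j · (M j · v) ≡ v
M⁻¹-M j@zero             = ⊗≡I₃⇒·-inverse (M⁻¹ j) (M j) refl
M⁻¹-M j@(suc zero)       = ⊗≡I₃⇒·-inverse (M⁻¹ j) (M j) refl
M⁻¹-M j@(suc (suc zero)) = ⊗≡I₃⇒·-inverse (M⁻¹ j) (M j) refl

M-M⁻¹ : ∀ j v → M j · (M⁻¹ j · v) ≡ v
M-M⁻¹ j@zero             = ⊗≡I₃⇒·-inverse (M j) (M⁻¹ j) refl
M-M⁻¹ j@(suc zero)       = ⊗≡I₃⇒·-inverse (M j) (M⁻¹ j) refl
M-M⁻¹ j@(suc (suc zero)) = ⊗≡I₃⇒·-inverse (M j) (M⁻¹ j) refl

-- The Lorentz form

form : Vec3 → ℤ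
form (x , y , z) = (x * x + y * y) - z * z

form-M : ∀ j v → form (M j · v) ≡ form v
form-M j (a , b , c) = preserved j a b c
  where
  open +-*-Solver
  P : Set
  P = Polynomial 3
  -- The matrix action and the form are repeated on solver polynomials, so the three equations need
  -- not be expanded by hand.
  dotP : Vec3 → P × P × P → P
  dotP (i , j , k) (x , y , z) = con i :* x :+ con j :* y :+ con k :* z
  formP : P × P × P → P
  formP (x , y , z) = (x :* x :+ y :* y) :- z :* z
  _·P_ : Mat3 → P × P × P → P × P × P
  (r₁ , r₂ , r₃) ·P v = dotP r₁ v , dotP r₂ v , dotP r₃ v
  preserved : ∀ j a b c → form (M j · (a , b , c)) ≡ form (a , b , c)
  preserved zero =
    solve 3 (λ a b c → formP (M₁ ·P (a , b , c)) := formP (a , b , c)) refl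
  preserved (suc zero) =
    solve 3 (λ a b c → formP (M₂ ·P (a , b , c)) := formP (a , b , c)) refl
  preserved (suc (suc zero)) =
    solve 3 (λ a b c → formP (M₃ ·P (a , b , c)) := formP (a , b , c)) refl

form-M⁻¹ : ∀ j v → form (M⁻¹ j · v) ≡ form v
form-M⁻¹ j v = trans (sym (form-M j (M⁻¹ j · v))) (cong form (M-M⁻¹ j v))

-- Coprimality

Coprime₃ : Vec3 → Set
Coprime₃ (a , b , c) = gcd (gcd a b) c ≡ + 1

_∣₃_ : ℤ → Vec3 → Set
d ∣₃ (a , b , c) = (d ∣ a) × (d ∣ b) × (d ∣ c)

gcd∣₃ : ∀ a b c → gcd (gcd a b) c ∣₃ (a , b , c)
gcd∣₃ a b c =
  ∣ᵤ⇒∣ (ℕ.∣-trans (gcd[i,j]∣i g c) (gcd[i,j]∣i a b)) ,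
  ∣ᵤ⇒∣ (ℕ.∣-trans (gcd[i,j]∣i g c) (gcd[i,j]∣j a b)) ,
  ∣ᵤ⇒∣ (gcd[i,j]∣j g c)
  where
  g : ℤ
  g = gcd a b

coprime₃-∣₃ : ∀ v {d} → Coprime₃ v → d ∣₃ v → d ∣ + 1
coprime₃-∣₃ (a , b , c) {d} cop (d∣a , d∣b , d∣c) =
  subst (d ∣_) cop (∣ᵤ⇒∣ (gcd-greatest {gcd a b} {c} {d}
    (gcd-greatest {a} {b} {d} (∣⇒∣ᵤ d∣a) (∣⇒∣ᵤ d∣b)) (∣⇒∣ᵤ d∣c)))

∣₃-dot : ∀ r v {d} → d ∣₃ v → d ∣ dot r v
∣₃-dot (i , j , k) _ (d∣x , d∣y , d∣z) =
  ∣m∣n⇒∣m+n (∣m∣n⇒∣m+n (∣n⇒∣m*n i d∣x) (∣n⇒∣m*n j d∣y)) (∣n⇒∣m*n k d∣z)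

-- A common divisor of the entries of `v` divides every integer combination of them, hence all
-- entries of `A · v`.
coprime₃-·⁻ : ∀ A v → Coprime₃ (A · v) → Coprime₃ v
coprime₃-·⁻ A@(r₁ , r₂ , r₃) v@(a , b , c) cop =
  cong +_ (ℕ.∣1⇒≡1 (∣⇒∣ᵤ (coprime₃-∣₃ (A · v) cop (∣₃-dot r₁ v g∣v , ∣₃-dot r₂ v g∣v , ∣₃-dot r₃ v g∣v))))
  where
  g∣v : gcd (gcd a b) c ∣₃ v
  g∣v = gcd∣₃ a b c

-- Primitive triples under M and M⁻¹

Positive₃ : Vec3 → Set
Positive₃ (a , b , c) = (+ 0 < a) × (+ 0 < b) × (+ 0 < c)

PPT⇒Positive₃ : ∀ {v} → PPT v → Positive₃ v
PPT⇒Positive₃ (0<a , 0<b , 0<c , _) = 0<a , 0<b , 0<c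

PPT⇒Coprime₃ : ∀ {v} → PPT v → Coprime₃ v
PPT⇒Coprime₃ (_ , _ , _ , cop , _) = cop

PPT⇒form≡0 : ∀ {v} → PPT v → form v ≡ + 0
PPT⇒form≡0 (_ , _ , _ , _ , pyth) = i≡j⇒i-j≡0 pyth

mkPPT : ∀ {v} → Positive₃ v → Coprime₃ v → form v ≡ + 0 → PPT v
mkPPT (0<a , 0<b , 0<c) cop form≡0 = 0<a , 0<b , 0<c , cop , i-j≡0⇒i≡j _ _ form≡0

-- Coprimality passes forward because `v` is itself the image of `M j · v` under the integer matrix
-- `M⁻¹ j`.
M-PPT : ∀ j v → PPT v → Positive₃ (M j · v) → PPT (M j · v)
M-PPT j v ppt pos = mkPPT pos
  (coprime₃-·⁻ (M⁻¹ j) (M j · v) (subst Coprime₃ (sym (M⁻¹-M j v)) (PPT⇒Coprime₃ ppt)))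
  (trans (form-M j v) (PPT⇒form≡0 ppt))

M⁻¹-PPT : ∀ j v → PPT v → Positive₃ (M⁻¹ j · v) → PPT (M⁻¹ j · v)
M⁻¹-PPT j v ppt pos = mkPPT pos
  (coprime₃-·⁻ (M j) (M⁻¹ j · v) (subst Coprime₃ (sym (M-M⁻¹ j v)) (PPT⇒Coprime₃ ppt)))
  (trans (form-M⁻¹ j v) (PPT⇒form≡0 ppt))

swap-PPT : ∀ {a b c} → PPT (a , b , c) → PPT (b , a , c)
swap-PPT {a} {b} {c} (0<a , 0<b , 0<c , cop , pyth) =
  0<b , 0<a , 0<c , trans (cong (λ g → gcd g c) (gcd-comm b a)) cop , trans (+-comm (b * b) (a * a)) pyth

-- Works modulo the ideal generated by a² + b² - c²: the multiplier `k` is a certificate that turns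
-- a consequence of the Pythagorean equation into a polynomial identity for the ring solver.
modulo-pythagoras : ∀ a b c {x y} k → a * a + b * b ≡ c * c →
                    x ≡ y + k * ((a * a + b * b) - c * c) → x ≡ y
modulo-pythagoras a b c {y = y} k pyth x≡ =
  trans x≡ (trans (cong (λ d → y + k * d) (i≡j⇒i-j≡0 pyth))
           (trans (cong (_+_ y) (*-zeroʳ k)) (+-identityʳ y)))

-- On the cone, (c + a)(c - a) = b² is positive.
leg<hypotenuse : ∀ {a b c} → PPT (a , b , c) → + 0 < c - a
leg<hypotenuse {a} {b} {c} (0<a , 0<b , 0<c , _ , pyth) =
  0<k*i⇒0<i (0<+ 0<c 0<a)
    (subst (+ 0 <_) (sym (modulo-pythagoras a b c (- + 1) pyth (identity a b c))) (0<* 0<b 0<b))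
  where
  identity : ∀ a b c → (c + a) * (c - a) ≡ b * b + - + 1 * ((a * a + b * b) - c * c)
  identity = solve-∀

-- All entries of `M₂` are positive. The negative entries of `M₁` and `M₃` are absorbed by grouping
-- them into copies of the positive differences c - a and c - b.
M-growth : ∀ j v → PPT v → Positive₃ (M j · v) × third v < third (M j · v)
M-growth zero v@(a , b , c) ppt@(0<a , 0<b , 0<c , _) =
  ( subst (+ 0 <_) (e₁ a b c) (0<+ (0<+ 0<b 0<b) (0<+ 0<c 0<c-a))
  , subst (+ 0 <_) (e₂ a b c) (0<+ 0<b (0<+ 0<c-a 0<c-a))
  , <-trans 0<c grows ) , grows
  where
  0<c-a : + 0 < c - a
  0<c-a = leg<hypotenuse ppt
  e₁ : ∀ a b c → (b + b) + (c + (c - a)) ≡ (- + 1) * a + + 2 * b + + 2 * c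
  e₁ = solve-∀
  e₂ : ∀ a b c → b + ((c - a) + (c - a)) ≡ (- + 2) * a + + 1 * b + + 2 * c
  e₂ = solve-∀
  e₃ : ∀ a b c → (b + b) + ((c - a) + (c - a)) ≡ ((- + 2) * a + + 2 * b + + 3 * c) - c
  e₃ = solve-∀
  grows : c < third (M₁ · v)
  grows = 0<j-i⇒i<j (subst (+ 0 <_) (e₃ a b c) (0<+ (0<+ 0<b 0<b) (0<+ 0<c-a 0<c-a)))
M-growth (suc zero) v@(a , b , c) (0<a , 0<b , 0<c , _) =
  ( subst (+ 0 <_) (e₁ a b c) (0<+ (0<+ 0<a (0<+ 0<b 0<b)) (0<+ 0<c 0<c))
  , subst (+ 0 <_) (e₂ a b c) (0<+ (0<+ 0<b (0<+ 0<a 0<a)) (0<+ 0<c 0<c))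
  , <-trans 0<c grows ) , grows
  where
  e₁ : ∀ a b c → (a + (b + b)) + (c + c) ≡ + 1 * a + + 2 * b + + 2 * c
  e₁ = solve-∀
  e₂ : ∀ a b c → (b + (a + a)) + (c + c) ≡ + 2 * a + + 1 * b + + 2 * c
  e₂ = solve-∀
  e₃ : ∀ a b c → ((a + a) + (b + b)) + (c + c) ≡ (+ 2 * a + + 2 * b + + 3 * c) - c
  e₃ = solve-∀
  grows : c < third (M₂ · v)
  grows = 0<j-i⇒i<j (subst (+ 0 <_) (e₃ a b c) (0<+ (0<+ (0<+ 0<a 0<a) (0<+ 0<b 0<b)) (0<+ 0<c 0<c)))
M-growth (suc (suc zero)) v@(a , b , c) ppt@(0<a , 0<b , 0<c , _) =
  ( subst (+ 0 <_) (e₁ a b c) (0<+ 0<a (0<+ 0<c-b 0<c-b))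
  , subst (+ 0 <_) (e₂ a b c) (0<+ (0<+ 0<a 0<a) (0<+ 0<c 0<c-b))
  , <-trans 0<c grows ) , grows
  where
  0<c-b : + 0 < c - b
  0<c-b = leg<hypotenuse (swap-PPT ppt)
  e₁ : ∀ a b c → a + ((c - b) + (c - b)) ≡ + 1 * a + (- + 2) * b + + 2 * c
  e₁ = solve-∀
  e₂ : ∀ a b c → (a + a) + (c + (c - b)) ≡ + 2 * a + (- + 1) * b + + 2 * c
  e₂ = solve-∀
  e₃ : ∀ a b c → (a + a) + ((c - b) + (c - b)) ≡ (+ 2 * a + (- + 2) * b + + 3 * c) - c
  e₃ = solve-∀
  grows : c < third (M₃ · v)
  grows = 0<j-i⇒i<j (subst (+ 0 <_) (e₃ a b c) (0<+ (0<+ 0<a 0<a) (0<+ 0<c-b 0<c-b)))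

-- Outgoing edges

edge-to-M : ∀ j v → PPT v → Edge v (M j · v)
edge-to-M j v ppt = ppt , M-PPT j v ppt (proj₁ (M-growth j v ppt)) , j , refl

edge⇒third< : ∀ {v w} → Edge v w → third v < third w
edge⇒third< {v} (ppt , _ , j , refl) = proj₂ (M-growth j v ppt)

outDegree3 : ∀ v → PPT v → OutDegree3 v
outDegree3 v@(a , b , c) ppt@(0<a , 0<b , 0<c , _) =
  M₁ · v , M₂ · v , M₃ · v ,
  edge-to-M zero v ppt , edge-to-M (suc zero) v ppt , edge-to-M (suc (suc zero)) v ppt ,
  M₁≢M₂ , M₁≢M₃ , M₂≢M₃ , exhausted
  where
  first second : Vec3 → ℤ
  first (x , _ , _) = x
  second (_ , y , _) = y
  separated : ∀ {i x y} → + 0 < i → i ≡ y - x → x ≢ y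
  separated {x = x} 0<i i≡ refl = <-irrefl (sym (trans i≡ (+-inverseʳ x))) 0<i
  -- Flipping the sign of the first column moves the first coordinate by 2a; below, flipping that of
  -- the second column moves the second coordinate by 2b.
  e₁₂ : ∀ a b c → a + a ≡ (+ 1 * a + + 2 * b + + 2 * c) - ((- + 1) * a + + 2 * b + + 2 * c)
  e₁₂ = solve-∀
  M₁≢M₂ : M₁ · v ≢ M₂ · v
  M₁≢M₂ eq = separated (0<+ 0<a 0<a) (e₁₂ a b c) (cong first eq)
  e₂₃ : ∀ a b c → b + b ≡ (+ 2 * a + + 1 * b + + 2 * c) - (+ 2 * a + (- + 1) * b + + 2 * c)
  e₂₃ = solve-∀
  M₂≢M₃ : M₂ · v ≢ M₃ · v
  M₂≢M₃ eq = separated (0<+ 0<b 0<b) (e₂₃ a b c) (sym (cong second eq))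
  -- Equality in the first two coordinates would give a = 2b and b = 2a.
  e₁₃ : ∀ a b c →
    (a + b) + (a + b) ≡ ((+ 2 * a + (- + 1) * b + + 2 * c) + ((- + 1) * a + + 2 * b + + 2 * c))
                      - (((- + 2) * a + + 1 * b + + 2 * c) + (+ 1 * a + (- + 2) * b + + 2 * c))
  e₁₃ = solve-∀
  M₁≢M₃ : M₁ · v ≢ M₃ · v
  M₁≢M₃ eq = separated (0<+ (0<+ 0<a 0<b) (0<+ 0<a 0<b)) (e₁₃ a b c)
    (cong₂ _+_ (cong second eq) (sym (cong first eq)))
  exhausted : ∀ w → Edge v w → w ≡ M₁ · v ⊎ w ≡ M₂ · v ⊎ w ≡ M₃ · v
  exhausted w (_ , _ , zero , eq) = inj₁ eq
  exhausted w (_ , _ , suc zero , eq) = inj₂ (inj₁ eq)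
  exhausted w (_ , _ , suc (suc zero) , eq) = inj₂ (inj₂ eq)

-- Parents

p-coord q-coord r-coord : Vec3 → ℤ
p-coord = dot (+ 1 , + 2 , (- + 2))
q-coord = dot (+ 2 , + 1 , (- + 2))
r-coord = dot ((- + 2) , (- + 2) , + 3)

negated-p : ∀ v → dot ((- + 1) , (- + 2) , + 2) v ≡ - p-coord v
negated-p (a , b , c) = identity a b c
  where
  identity : ∀ a b c → (- + 1) * a + (- + 2) * b + + 2 * c ≡ - (+ 1 * a + + 2 * b + (- + 2) * c)
  identity = solve-∀

negated-q : ∀ v → dot ((- + 2) , (- + 1) , + 2) v ≡ - q-coord v
negated-q (a , b , c) = identity a b c
  where
  identity : ∀ a b c → (- + 2) * a + (- + 1) * b + + 2 * c ≡ - (+ 2 * a + + 1 * b + (- + 2) * c)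
  identity = solve-∀

-- Exchanging the legs exchanges p and q, so the facts about q come from those about p.
q-coord-swap : ∀ a b c → q-coord (a , b , c) ≡ p-coord (b , a , c)
q-coord-swap = identity
  where
  identity : ∀ a b c → + 2 * a + + 1 * b + (- + 2) * c ≡ + 1 * b + + 2 * a + (- + 2) * c
  identity = solve-∀

-- The right-hand side is independent of `j`; uniqueness of the parent rests on this.
positive-M⁻¹ : ∀ j v → Positive₃ (M⁻¹ j · v) →
               M⁻¹ j · v ≡ (+ ∣ p-coord v ∣ , + ∣ q-coord v ∣ , r-coord v)
positive-M⁻¹ zero v (0<x , 0<y , _) =
  cong₃ (trans (negated-p v) (0<-i⇒-i≡+∣i∣ (subst (+ 0 <_) (negated-p v) 0<x))) (0<i⇒i≡+∣i∣ 0<y) refl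
positive-M⁻¹ (suc zero) v (0<x , 0<y , _) =
  cong₃ (0<i⇒i≡+∣i∣ 0<x) (0<i⇒i≡+∣i∣ 0<y) refl
positive-M⁻¹ (suc (suc zero)) v (0<x , 0<y , _) =
  cong₃ (0<i⇒i≡+∣i∣ 0<x) (trans (negated-q v) (0<-i⇒-i≡+∣i∣ (subst (+ 0 <_) (negated-q v) 0<y))) refl

-- Multiplying by the conjugate 2a + 2b + 3c gives 9c² - 4(a + b)², which on the cone equals a² + b²
-- + 4(a - b)².
0<r-coord : ∀ v → PPT v → + 0 < r-coord v
0<r-coord (a , b , c) (0<a , 0<b , 0<c , _ , pyth) =
  0<k*i⇒0<i (0<+ (0<+ (0<* 0<2 0<a) (0<* 0<2 0<b)) (0<* 0<3 0<c))
    (subst (+ 0 <_) (sym (modulo-pythagoras a b c (- + 9) pyth (identity a b c))) 0<rhs)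
  where
  0<2 : + 0 < + 2
  0<2 = +<+ (ℕ.s≤s ℕ.z≤n)
  0<3 : + 0 < + 3
  0<3 = +<+ (ℕ.s≤s ℕ.z≤n)
  identity : ∀ a b c →
    (+ 2 * a + + 2 * b + + 3 * c) * ((- + 2) * a + (- + 2) * b + + 3 * c)
      ≡ (a * a + b * b + + 4 * ((a - b) * (a - b))) + (- + 9) * ((a * a + b * b) - c * c)
  identity = solve-∀
  0≤i*i : ∀ i → + 0 ≤ i * i
  0≤i*i (+ 0) = +≤+ ℕ.z≤n
  0≤i*i (+ ℕ.suc n) = +≤+ ℕ.z≤n
  0≤i*i (-[1+ n ]) = +≤+ ℕ.z≤n
  0<rhs : + 0 < a * a + b * b + + 4 * ((a - b) * (a - b))
  0<rhs = +-mono-<-≤ (0<+ (0<* 0<a 0<a) (0<* 0<b 0<b)) (*-monoˡ-≤-nonNeg (+ 4) (0≤i*i (a - b)))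

-- The product is (a + 2b)² - 4c², and c² = a² + b² eliminates c.
p-coord-conjugate : ∀ {a b c} → PPT (a , b , c) →
  (+ 1 * a + + 2 * b + + 2 * c) * p-coord (a , b , c) ≡ a * (+ 4 * b - + 3 * a)
p-coord-conjugate {a} {b} {c} (_ , _ , _ , _ , pyth) = modulo-pythagoras a b c (+ 4) pyth (identity a b c)
  where
  identity : ∀ a b c → (+ 1 * a + + 2 * b + + 2 * c) * (+ 1 * a + + 2 * b + (- + 2) * c)
    ≡ a * (+ 4 * b - + 3 * a) + + 4 * ((a * a + b * b) - c * c)
  identity = solve-∀

p-coord<0⇒0<3a-4b : ∀ {a b c} → PPT (a , b , c) → p-coord (a , b , c) < + 0 → + 0 < + 3 * a - + 4 * b
p-coord<0⇒0<3a-4b {a} {b} {c} ppt@(0<a , _) p<0 =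
  -- The conjugate factor is the first coordinate of `M₂ · v`, so `M-growth` supplies its
  -- positivity.
  0<k*i⇒0<i 0<a (subst (+ 0 <_) eq (0<* (proj₁ (proj₁ (M-growth (suc zero) _ ppt))) (neg-mono-< p<0)))
  where
  flip : ∀ a b → - (a * (+ 4 * b - + 3 * a)) ≡ a * (+ 3 * a - + 4 * b)
  flip = solve-∀
  eq : (+ 1 * a + + 2 * b + + 2 * c) * (- p-coord (a , b , c)) ≡ a * (+ 3 * a - + 4 * b)
  eq = trans (sym (neg-distribʳ-* (+ 1 * a + + 2 * b + + 2 * c) (p-coord (a , b , c)))) (trans (cong -_ (p-coord-conjugate ppt)) (flip a b))

-- With 4b = 3a and 2c = a + 2b, the triple is (4k , 3k , 5k) for k = a − b.
p-coord≡0⇒4-3-5 : ∀ {a b c} → PPT (a , b , c) → p-coord (a , b , c) ≡ + 0 → (a , b , c) ≡ (+ 4 , + 3 , + 5)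
p-coord≡0⇒4-3-5 {a} {b} {c} ppt@(0<a , _) p≡0 = cong₃ (numeric a≡4k) (numeric b≡3k) (numeric c≡5k)
  where
  k : ℤ
  k = a - b
  4b-3a≡0 : + 4 * b - + 3 * a ≡ + 0
  4b-3a≡0 = *-cancelˡ-0< 0<a (trans (sym (p-coord-conjugate ppt))
    (trans (cong (_*_ (+ 1 * a + + 2 * b + + 2 * c)) p≡0)
    (trans (*-zeroʳ (+ 1 * a + + 2 * b + + 2 * c)) (sym (*-zeroʳ a)))))
  e₄ : ∀ a b → + 4 * (a - b) + (+ 4 * b - + 3 * a) ≡ a
  e₄ = solve-∀
  a≡4k : a ≡ + 4 * k
  a≡4k = trans (sym (e₄ a b)) (trans (cong (_+_ (+ 4 * k)) 4b-3a≡0) (+-identityʳ (+ 4 * k)))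
  e₃ : ∀ a b → + 3 * (a - b) + (+ 4 * b - + 3 * a) ≡ b
  e₃ = solve-∀
  b≡3k : b ≡ + 3 * k
  b≡3k = trans (sym (e₃ a b)) (trans (cong (_+_ (+ 3 * k)) 4b-3a≡0) (+-identityʳ (+ 3 * k)))
  -- The last two terms are three times 4b - 3a and p itself; both vanish, leaving 2c = 10k.
  e₅ : ∀ a b c → + 2 * c ≡
    + 2 * (+ 5 * (a - b)) + + 3 * (+ 4 * b - + 3 * a) - (+ 1 * a + + 2 * b + (- + 2) * c)
  e₅ = solve-∀
  c≡5k : c ≡ + 5 * k
  c≡5k = *-cancelˡ-≡ (+ 2) c (+ 5 * k) (trans (e₅ a b c)
    (trans (cong₂ (λ x y → + 2 * (+ 5 * k) + + 3 * x - y) 4b-3a≡0 p≡0) (drop-0 (+ 2 * (+ 5 * k)))))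
    where
    drop-0 : ∀ i → i + + 3 * + 0 - + 0 ≡ i
    drop-0 = solve-∀
  -- `k` divides all three entries and is positive because a = 4k, so primitivity applies.
  k≡1 : k ≡ + 1
  k≡1 = 0<i∧i∣1⇒i≡1 (0<k*i⇒0<i {+ 4} (+<+ (ℕ.s≤s ℕ.z≤n)) (subst (+ 0 <_) a≡4k 0<a))
    (coprime₃-∣₃ (a , b , c) (PPT⇒Coprime₃ ppt) (divides (+ 4) a≡4k , divides (+ 3) b≡3k , divides (+ 5) c≡5k))
  numeric : ∀ {x n} → x ≡ n * k → x ≡ n
  numeric {n = n} x≡nk = trans x≡nk (trans (cong (n *_) k≡1) (*-identityʳ n))

-- The signs would give 3a > 4b and 3b > 4a, whose sum contradicts a + b > 0.
p-coord<0∧q-coord<0⇒⊥ : ∀ {a b c} → PPT (a , b , c) →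
  p-coord (a , b , c) < + 0 → q-coord (a , b , c) < + 0 → ⊥
p-coord<0∧q-coord<0⇒⊥ {a} {b} {c} ppt@(0<a , 0<b , _) p<0 q<0 =
  <-irrefl (sym (identity a b)) (0<+ (0<+ (p-coord<0⇒0<3a-4b ppt p<0)
    (p-coord<0⇒0<3a-4b (swap-PPT ppt) (subst (_< + 0) (q-coord-swap a b c) q<0))) (0<+ 0<a 0<b))
  where
  identity : ∀ a b → ((+ 3 * a - + 4 * b) + (+ 3 * b - + 4 * a)) + (a + b) ≡ + 0
  identity = solve-∀

q-coord≡0⇒3-4-5 : ∀ {a b c} → PPT (a , b , c) → q-coord (a , b , c) ≡ + 0 → (a , b , c) ≡ (+ 3 , + 4 , + 5)
q-coord≡0⇒3-4-5 {a} {b} {c} ppt q≡0 =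
  cong (λ (x , y , z) → (y , x , z)) (p-coord≡0⇒4-3-5 (swap-PPT ppt) (trans (sym (q-coord-swap a b c)) q≡0))

-- The signs select the matrix: `M₁` when p is negative, `M₃` when q is negative, `M₂` when both are
-- positive.
∃-positive-M⁻¹ : ∀ v → PPT v → v ≢ (+ 3 , + 4 , + 5) → v ≢ (+ 4 , + 3 , + 5) →
                 ∃[ j ] Positive₃ (M⁻¹ j · v)
∃-positive-M⁻¹ v ppt v≢345 v≢435 with <-cmp (p-coord v) (+ 0) | <-cmp (q-coord v) (+ 0)
... | tri≈ _ p≡0 _ | _            = ⊥-elim (v≢435 (p-coord≡0⇒4-3-5 ppt p≡0))
... | _            | tri≈ _ q≡0 _ = ⊥-elim (v≢345 (q-coord≡0⇒3-4-5 ppt q≡0))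
... | tri< p<0 _ _ | tri< q<0 _ _ = ⊥-elim (p-coord<0∧q-coord<0⇒⊥ ppt p<0 q<0)
... | tri< p<0 _ _ | tri> _ _ 0<q =
  zero , subst (+ 0 <_) (sym (negated-p v)) (neg-mono-< p<0) , 0<q , 0<r-coord v ppt
... | tri> _ _ 0<p | tri> _ _ 0<q =
  suc zero , 0<p , 0<q , 0<r-coord v ppt
... | tri> _ _ 0<p | tri< q<0 _ _ =
  suc (suc zero) , 0<p , subst (+ 0 <_) (sym (negated-q v)) (neg-mono-< q<0) , 0<r-coord v ppt

edge-from-M⁻¹ : ∀ j v → PPT v → Positive₃ (M⁻¹ j · v) → Edge (M⁻¹ j · v) v
edge-from-M⁻¹ j v ppt pos = M⁻¹-PPT j v ppt pos , ppt , j , sym (M-M⁻¹ j v)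

-- Any parent is `M⁻¹ j · v` for the index `j` of its edge, and it is positive as a triple, so
-- `positive-M⁻¹` determines it from `v` alone.
parent-unique : ∀ {u v} → Edge u v → u ≡ (+ ∣ p-coord v ∣ , + ∣ q-coord v ∣ , r-coord v)
parent-unique {u} (ppt , _ , j , refl) =
  trans (sym (M⁻¹-M j u))
    (positive-M⁻¹ j (M j · u) (subst Positive₃ (sym (M⁻¹-M j u)) (PPT⇒Positive₃ ppt)))

theorem2p2 : ∀ v → PPT v → v ≢ (+ 3 , + 4 , + 5) → v ≢ (+ 4 , + 3 , + 5) → Funnel v
theorem2p2 v ppt v≢345 v≢435 with ∃-positive-M⁻¹ v ppt v≢345 v≢435
... | j , pos =
  ppt , outDegree3 v ppt , (λ w → edge⇒third<) ,
  M⁻¹ j · v , (parent , λ u′ e → trans (parent-unique e) (sym (parent-unique parent))) , edge⇒third< parent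
  where
  parent : Edge (M⁻¹ j · v) v
  parent = edge-from-M⁻¹ j v ppt pos
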